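{- Let $G=(V,E)$ be a finite graph. Choosing $A,B\subseteq E$ independently and uniformly at random, the event that $|A|+|B|\equiv 0$ or $1 \pmod 4$ (i.e. that $\left\lfloor\frac{|A|+|B|}{2}\right\rfloor$ is even) is correlated with the event $\Delta$ that $A\bigtriangleup B$ is eulerian in the following way: $$\frac{\mathrm{Bias}(|A|+|B|\equiv 0,1\ (\mathrm{mod}\ 4)\,\mid\,\Delta)}{\mathrm{Bias}(|A|+|B|\equiv 0,1\ (\mathrm{mod}\ 4))}=2^{r(G)}F(G;2).$$
   Context: Graphs are finite; loops and parallel edges are permitted. A subset $A\subseteq E$ is identified with the subgraph $(V,A)$ of $G$; it is called eulerian if all its vertex degrees are even (a loop contributes 2 to the degree). $\bigtriangleup$ is symmetric difference of sets. $r(G)=|V|-k(G)$, where $k(G)$ is the number of connected components of $G$. $F(G;q)$ is the number of nowhere-zero $\mathbb{Z}_q$-flows of $G$ (with respect to any fixed orientation). For an event $\Sigma$, $\mathrm{Bias}(\Sigma)=\mathbb{P}(\Sigma)-\mathbb{P}(\overline{\Sigma})$ and $\mathrm{Bias}(\Sigma\mid\Delta)=\mathbb{P}(\Sigma\mid\Delta)-\mathbb{P}(\overline{\Sigma}\mid\Delta)$, where $\overline{\Sigma}$ is the complement of $\Sigma$. -}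

module Defs where

open import Algebra.Properties.Monoid.Sum using (sum-syntax)
open import Data.Bool.Base using (if_then_else_; _xor_)
open import Data.Fin.Base using (Fin; zero; suc; toℕ; punchIn; punchOut)
open import Data.Fin.Properties as Fin
  using (punchOut-cong; punchOut-injective; punchInᵢ≢i; punchOut-punchIn; all?)
open import Data.Fin.Subset using (Subset; inside; outside; ∣_∣; ⊥)
open import Data.Integer.Base using (+_)
open import Data.List.Base
  using (List; []; _∷_; [_]; length; filter; allFin; cartesianProduct; cartesianProductWith)
open import Data.List.Membership.Propositional using (_∈_)
open import Data.List.Membership.Propositional.Properties
  using (∈-cartesianProductWith⁺; ∈-cartesianProduct⁺; ∈-length)
open import Data.List.Relation.Unary.All using ([]; _∷_)
open import Data.List.Relation.Unary.AllPairs using ([]; _∷_)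
open import Data.List.Relation.Unary.Any using (here; there)
open import Data.List.Relation.Unary.Unique.Propositional using (Unique)
open import Data.List.Relation.Unary.Unique.Propositional.Properties
  using (cartesianProductWith⁺)
open import Data.Nat.Base as ℕ using (ℕ; zero; suc; _+_; _*_; _∸_; _%_)
open import Data.Nat.Divisibility using (_∣_; _∣?_)
open import Data.Nat.Properties as ℕ using (+-0-monoid)
open import Data.Product.Base using (∃; _×_; _,_; proj₁; proj₂; swap)
open import Data.Rational.Base as ℚ using (ℚ; _/_; _-_; _÷_)
open import Data.Sum.Base using (_⊎_; inj₁; inj₂)
open import Data.Vec.Base using (Vec; []; _∷_; lookup; zipWith)
open import Data.Vec.Properties using (∷-injective)
open import Function.Base using (_∘_; case_of_)
open import Function.Bundles using (Bijection)
open import Level using (0ℓ)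
open import Relation.Binary.Construct.Closure.Equivalence as Eq using (EqClosure)
open import Relation.Binary.Construct.Closure.ReflexiveTransitive using (ε; _◅_)
open import Relation.Binary.Construct.Closure.Symmetric using (fwd)
open import Relation.Binary.Core using (Rel)
open import Relation.Binary.PropositionalEquality
  using (_≡_; _≢_; refl; sym; trans; setoid; isEquivalence)
open import Relation.Nullary using (Dec; yes; no; does; contradiction; _⊎-dec_; ¬?)
open import Relation.Unary using (Pred; Decidable)
open import Relation.Unary.Properties using (∁?; _∩?_)

-- The pair of ends of an edge is to be read as unordered: its order carries
-- no meaning (orientations are separate data, below).
record Graph : Set where
  field
    #V   : ℕ
    #E   : ℕ
    ends : Fin #E → Fin #V × Fin #V

record Orientation (G : Graph) : Set where
  open Graph G
  field
    tail head : Fin #E → Fin #V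
    orients   : ∀ e → (tail e , head e) ≡ ends e ⊎ (tail e , head e) ≡ swap (ends e)

Joined : ∀ {n m} → (Fin m → Fin n × Fin n) → Rel (Fin n) 0ℓ
Joined ends u v = ∃ λ e → ends e ≡ (u , v)

-- The number of components is the k for which V modulo connectedness is in
-- bijection with Fin k.  It is computed by adding the edges one at a time; an
-- edge between different components merges its two ends' components.
Classes : ∀ {n m} → (Fin m → Fin n × Fin n) → ℕ → Set
Classes ends k = Bijection (Eq.setoid (Joined ends)) (setoid (Fin k))

private
  module Step {n m} (ends : Fin (suc m) → Fin n × Fin n) where

    a b : Fin n
    a = proj₁ (ends zero)
    b = proj₂ (ends zero)

    _~_ = EqClosure (Joined ends)

    lift : ∀ {u v} → EqClosure (Joined (ends ∘ suc)) u v → u ~ v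
    lift = Eq.map λ (e , p) → suc e , p

    a~b : a ~ b
    a~b = fwd (zero , refl) ◅ ε

    ~-trans : ∀ {u v w} → u ~ v → v ~ w → u ~ w
    ~-trans = Eq.transitive (Joined ends)

    ~-sym : ∀ {u v} → u ~ v → v ~ u
    ~-sym = Eq.symmetric (Joined ends)

    -- A map that respects the old edges and identifies the ends of the new one.
    respects : ∀ {k} (f : Fin n → Fin k) → f a ≡ f b →
               (∀ {u v} → EqClosure (Joined (ends ∘ suc)) u v → f u ≡ f v) →
               ∀ {u v} → u ~ v → f u ≡ f v
    respects f fa≡fb old = Eq.gfold isEquivalence f λ where
      (zero  , refl) → fa≡fb
      (suc e , p)    → old (fwd (e , p) ◅ ε)

    module _ {k} (c : Classes (ends ∘ suc) k) where
      open Bijection c using (to) renaming (cong to to-cong; injective to to-injective)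

      hit : ∀ y → ∃ λ u → to u ≡ y
      hit = Bijection.strictlySurjective c

      keep : to a ≡ to b → Classes ends k
      keep p = record
        { to        = to
        ; cong      = respects to p to-cong
        ; bijective = (lift ∘ to-injective)
                    , λ y → proj₁ (hit y)
                          , λ q → trans (respects to p to-cong q) (proj₂ (hit y))
        }

    module _ {k} (c : Classes (ends ∘ suc) (suc k))
             (a≢b : Bijection.to c a ≢ Bijection.to c b) where
      open Bijection c using (to) renaming (cong to to-cong; injective to to-injective)

      redirect : (x : Fin (suc k)) → Dec (to a ≡ x) → Fin k
      redirect x (yes _)  = punchOut a≢b
      redirect x (no a≢x) = punchOut a≢x

      in-a? : ∀ u → Dec (to a ≡ to u)
      in-a? u = to a Fin.≟ to u

      new : Fin n → Fin k
      new u = redirect (to u) (in-a? u)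

      redirect-cong : ∀ {x y} (p : Dec (to a ≡ x)) (q : Dec (to a ≡ y)) → x ≡ y →
                      redirect x p ≡ redirect y q
      redirect-cong (yes _)    (yes _)    _ = refl
      redirect-cong (yes refl) (no a≢a)   refl = contradiction refl a≢a
      redirect-cong (no a≢a)   (yes refl) refl = contradiction refl a≢a
      redirect-cong (no _)     (no _)     p = punchOut-cong (to a) p

      redirect-ends : (p : Dec (to a ≡ to a)) (q : Dec (to a ≡ to b)) →
                      redirect (to a) p ≡ redirect (to b) q
      redirect-ends (no a≢a) _       = contradiction refl a≢a
      redirect-ends _        (yes p) = contradiction p a≢b
      redirect-ends (yes _)  (no _)  = punchOut-cong (to a) refl

      old : ∀ {u v} → to u ≡ to v → u ~ v
      old = lift ∘ to-injective

      redirect-injective : ∀ {u v} (p : Dec (to a ≡ to u)) (q : Dec (to a ≡ to v)) →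
                           redirect (to u) p ≡ redirect (to v) q → u ~ v
      redirect-injective (yes p)  (yes q)  _ = old (trans (sym p) q)
      redirect-injective (yes p)  (no a≢v) r =
        ~-trans (old (sym p)) (~-trans a~b (old (punchOut-injective a≢b a≢v r)))
      redirect-injective (no a≢u) (yes q)  r =
        ~-trans (old (punchOut-injective a≢u a≢b r)) (~-trans (~-sym a~b) (old q))
      redirect-injective (no a≢u) (no a≢v) r = old (punchOut-injective a≢u a≢v r)

      new-cong : ∀ {u v} → u ~ v → new u ≡ new v
      new-cong = respects new (redirect-ends (in-a? a) (in-a? b))
                   λ {u} {v} p → redirect-cong (in-a? u) (in-a? v) (to-cong p)

      redirect-hit : ∀ {x} y (p : Dec (to a ≡ x)) → x ≡ punchIn (to a) y → redirect x p ≡ y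
      redirect-hit y (yes p)  q = contradiction (sym (trans p q)) (punchInᵢ≢i (to a) y)
      redirect-hit y (no a≢x) q = trans (punchOut-cong (to a) q) (punchOut-punchIn (to a))

      merge : Classes ends k
      merge = record
        { to        = new
        ; cong      = new-cong
        ; bijective = (λ {u} {v} → redirect-injective (in-a? u) (in-a? v))
                    , λ y → let (u , p) = hit c (punchIn (to a) y) in
                            u , λ q → trans (new-cong q) (redirect-hit y (in-a? u) p)
        }

    step : ∃ (Classes (ends ∘ suc)) → ∃ (Classes ends)
    step (k , c) with Bijection.to c a Fin.≟ Bijection.to c b
    ... | yes p = k , keep c p
    step (suc k , c) | no a≢b = k , merge c a≢b
    step (zero  , c) | no _   = case Bijection.to c a of λ ()

classes : ∀ {n m} (ends : Fin m → Fin n × Fin n) → ∃ (Classes ends)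
classes {n} {zero}  ends = n , record
  { to        = λ u → u
  ; cong      = edgeless
  ; bijective = (λ { refl → ε }) , λ y → y , edgeless
  }
  where
  edgeless : ∀ {u v} → EqClosure (Joined ends) u v → u ≡ v
  edgeless = Eq.fold isEquivalence λ ()
classes {m = suc m} ends = Step.step ends (classes (ends ∘ suc))

k : Graph → ℕ
k G = proj₁ (classes (Graph.ends G))

r : Graph → ℕ
r G = Graph.#V G ∸ k G

words : ∀ {A : Set} → List A → ∀ n → List (Vec A n)
words xs zero    = [ [] ]
words xs (suc n) = cartesianProductWith _∷_ xs (words xs n)

∈-words : ∀ {A : Set} {xs : List A} → (∀ x → x ∈ xs) → ∀ {n} (w : Vec A n) → w ∈ words xs n
∈-words all∈ []      = here refl
∈-words all∈ (x ∷ w) = ∈-cartesianProductWith⁺ _∷_ (all∈ x) (∈-words all∈ w)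

words-unique : ∀ {A : Set} {xs : List A} → Unique xs → ∀ n → Unique (words xs n)
words-unique u zero    = [] ∷ []
words-unique u (suc n) = cartesianProductWith⁺ _∷_ ∷-injective u (words-unique u n)

subsets : ∀ n → List (Subset n)
subsets = words (outside ∷ inside ∷ [])

∈-subsets : ∀ {n} (A : Subset n) → A ∈ subsets n
∈-subsets = ∈-words λ where
  outside → here refl
  inside  → there (here refl)

∑ : ∀ {n} → (Fin n → ℕ) → ℕ
∑ {n} f = sum-syntax +-0-monoid n f

𝟙 : ∀ {P : Set} → Dec P → ℕ
𝟙 P? = if does P? then 1 else 0

module _ (G : Graph) where
  open Graph G

  degree : Subset #E → Fin #V → ℕ
  degree A v = ∑ λ e →
    if lookup A e then 𝟙 (proj₁ (ends e) Fin.≟ v) + 𝟙 (proj₂ (ends e) Fin.≟ v) else 0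

  Eulerian : Pred (Subset #E) 0ℓ
  Eulerian A = ∀ v → 2 ∣ degree A v

  eulerian? : Decidable Eulerian
  eulerian? A = all? λ v → 2 ∣? degree A v

  module _ (o : Orientation G) (q : ℕ) .{{_ : ℕ.NonZero q}} where
    open Orientation o

    -- Elements of ℤ/q are represented by their residues 0, …, q - 1.
    outflow inflow : Vec (Fin q) #E → Fin #V → ℕ
    outflow f v = ∑ λ e → 𝟙 (tail e Fin.≟ v) * toℕ (lookup f e)
    inflow  f v = ∑ λ e → 𝟙 (head e Fin.≟ v) * toℕ (lookup f e)

    IsFlow NowhereZero : Pred (Vec (Fin q) #E) 0ℓ
    IsFlow      f = ∀ v → outflow f v % q ≡ inflow f v % q
    NowhereZero f = ∀ e → toℕ (lookup f e) ≢ 0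

    isFlow? : Decidable IsFlow
    isFlow? f = all? λ v → outflow f v % q ℕ.≟ inflow f v % q

    nowhereZero? : Decidable NowhereZero
    nowhereZero? f = all? λ e → ¬? (toℕ (lookup f e) ℕ.≟ 0)

    F : ℕ
    F = length (filter (isFlow? ∩? nowhereZero?) (words (allFin q) #E))

-- Choosing two subsets independently and uniformly is choosing a pair of
-- subsets uniformly; every probability below is over that choice.
module _ {m : ℕ} where

  samples : List (Subset m × Subset m)
  samples = cartesianProduct (subsets m) (subsets m)

  instance
    samples≢0 : ℕ.NonZero (length samples)
    samples≢0 = ℕ.>-nonZero (∈-length (∈-cartesianProduct⁺ (∈-subsets {m} ⊥) (∈-subsets {m} ⊥)))

  private
    variable
      P Q : Pred (Subset m × Subset m) 0ℓ

  ℙ : Decidable P → ℚ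
  ℙ P? = + length (filter P? samples) / length samples

  ℙ[_∣_] : Decidable P → (Q? : Decidable Q) → .{{_ : ℚ.NonZero (ℙ Q?)}} → ℚ
  ℙ[ P? ∣ Q? ] = ℙ (P? ∩? Q?) ÷ ℙ Q?

  Bias : Decidable P → ℚ
  Bias P? = ℙ P? - ℙ (∁? P?)

  Bias[_∣_] : Decidable P → (Q? : Decidable Q) → .{{_ : ℚ.NonZero (ℙ Q?)}} → ℚ
  Bias[ P? ∣ Q? ] = ℙ[ P? ∣ Q? ] - ℙ[ ∁? P? ∣ Q? ]

infixl 6 _△_

_△_ : ∀ {m} → Subset m → Subset m → Subset m
_△_ = zipWith _xor_

Size≡0,1[mod4] : ∀ {m} → Pred (Subset m × Subset m) 0ℓ
Size≡0,1[mod4] (A , B) = (∣ A ∣ + ∣ B ∣) % 4 ≡ 0 ⊎ (∣ A ∣ + ∣ B ∣) % 4 ≡ 1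

size≡0,1[mod4]? : ∀ {m} → Decidable (Size≡0,1[mod4] {m})
size≡0,1[mod4]? (A , B) = ((∣ A ∣ + ∣ B ∣) % 4 ℕ.≟ 0) ⊎-dec ((∣ A ∣ + ∣ B ∣) % 4 ℕ.≟ 1)

△-Eulerian : (G : Graph) → Pred (Subset (Graph.#E G) × Subset (Graph.#E G)) 0ℓ
△-Eulerian G (A , B) = Eulerian G (A △ B)

△-eulerian? : (G : Graph) → Decidable (△-Eulerian G)
△-eulerian? G (A , B) = eulerian? G (A △ B)

{-# OPTIONS --safe #-}
module Submission where

-- Let f(j) = 1 for j ≡ 0, 1 (mod 4) and f(j) = -1 otherwise, so that f(j + 2) = -f(j).
-- Fix C = A △ B.  If some edge e is not in C, toggling e in both A and B changes
-- |A| + |B| by 2, so the signs f(|A| + |B|) cancel; only C = E contributes, and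
-- hence Σ h(A △ B) f(|A| + |B|) = 2^|E| h(E) f(|E|) for every weight h.  With h = 1
-- this is the unconditional bias, with h the indicator of the eulerian sets it is
-- the conditional one.  Their ratio is 2^|E| / #{eulerian sets} if E is eulerian
-- and 0 otherwise.  Finally F(G;2) is 1 or 0 according as E is eulerian or not, and
-- #{eulerian sets} = 2^(|E| - r(G)): a new edge doubles the number of eulerian sets
-- when its ends are already connected, and otherwise lies in no eulerian set.

open import Defs
open import Algebra.Properties.CommutativeMonoid.Sum using (∑-distrib-+)
open import Algebra.Properties.Monoid.Sum using (sum-cong-≗)
open import Data.Bool.Base using (if_then_else_; true; false; _xor_)
open import Data.Fin.Base using (Fin; zero; suc; toℕ)
open import Data.Fin.Properties using (_≟_; all?)
open import Data.Fin.Subset using (Subset; inside; outside; ∣_∣; ⊥; ⊤; ⁅_⁆)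
open import Data.Integer.Base as ℤ using (ℤ; +_)
import Data.Integer.Properties as ℤ
import Data.Integer.Tactic.RingSolver as ℤ-Solver
open import Data.List.Base
  using (List; []; _∷_; _++_; map; length; filter; allFin; cartesianProductWith)
open import Data.Nat.Base using (ℕ; zero; suc; _*_; _^_; _∸_; _%_; _≤_)
import Data.Nat.Base as ℕ
open import Data.Nat.Divisibility
  using (_∣_; divides; _∣?_; _∣0; n∣m*n; ∣m∣n⇒∣m+n; ∣m+n∣m⇒∣n; ∣n⇒∣m*n; ∣1⇒≡1)
open import Data.Nat.DivMod using (m≡m%n+[m/n]*n; [m+kn]%n≡m%n)
import Data.Nat.Properties as ℕ
import Data.Nat.Tactic.RingSolver as ℕ-Solver
open import Data.Product.Base using (Σ-syntax; ∃; _×_; _,_; proj₁; proj₂)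
open import Data.Rational.Base as ℚ using (NonZero; _/_; _÷_; toℚᵘ; 1/_; ≢-nonZero)
import Data.Rational.Properties as ℚ
open import Data.Rational.Unnormalised.Base as ℚᵘ using (mkℚᵘ; *≡*)
import Data.Rational.Unnormalised.Properties as ℚᵘ
open import Data.Sum.Base using (_⊎_; inj₁; inj₂)
open import Data.Vec.Base using (Vec; []; _∷_; lookup; replicate)
open import Data.Vec.Properties using (lookup-replicate)
open import Function.Base using (_∘_; case_of_)
open import Function.Bundles using (Bijection; mk⇔)
open import Level using (0ℓ)
open import Relation.Binary.Construct.Closure.Equivalence as Eq using (EqClosure)
open import Relation.Binary.PropositionalEquality
  using (_≡_; _≢_; refl; sym; trans; cong; cong₂; subst; module ≡-Reasoning)
open import Relation.Binary.Structures using (IsEquivalence)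
open import Relation.Nullary using (Dec; yes; no; does; ¬_; _⊎-dec_)
open import Relation.Nullary.Decidable using (does-⇔; dec-true; dec-false)
open import Relation.Unary using (Pred; Decidable)
open import Relation.Unary.Properties using (∁?; _∩?_)

private
  variable
    X Y Z P Q : Set
    m n : ℕ

-- Ratios of rationals

toℚᵘ-/ : ∀ i n → toℚᵘ (i / suc n) ℚᵘ.≃ mkℚᵘ i n
toℚᵘ-/ i n = ℚ.toℚᵘ-fromℚᵘ (mkℚᵘ i n)

/-distrib-minus : ∀ i j n .{{_ : ℕ.NonZero n}} → i / n ℚ.- j / n ≡ (i ℤ.- j) / n
/-distrib-minus i j n@(suc n-1) = ℚ.toℚᵘ-injective (begin
  toℚᵘ (i / n ℚ.- j / n)                 ≈⟨ ℚ.toℚᵘ-homo-+ (i / n) (ℚ.- (j / n)) ⟩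
  toℚᵘ (i / n) ℚᵘ.+ toℚᵘ (ℚ.- (j / n))   ≈⟨ ℚᵘ.+-cong (toℚᵘ-/ i n-1)
                                             (ℚᵘ.≃-trans (ℚ.toℚᵘ-homo‿- (j / n))
                                                         (ℚᵘ.-‿cong (toℚᵘ-/ j n-1))) ⟩
  mkℚᵘ i n-1 ℚᵘ.- mkℚᵘ j n-1             ≈⟨ *≡* (ring i j (+ n)) ⟩
  mkℚᵘ (i ℤ.- j) n-1                     ≈⟨ toℚᵘ-/ (i ℤ.- j) n-1 ⟨
  toℚᵘ ((i ℤ.- j) / n)                   ∎)
  where
  open ℚᵘ.≃-Reasoning
  ring : ∀ i j k → (i ℤ.* k ℤ.+ (ℤ.- j) ℤ.* k) ℤ.* k ≡ (i ℤ.- j) ℤ.* (k ℤ.* k)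
  ring = ℤ-Solver.solve-∀

-- The right side is `t * j * d` over the square of `n`, so cross-multiplying and cancelling one `n`
-- leaves the integer identity in the hypothesis. This turns the claim about probabilities into a
-- claim about counts of samples.
/-≡-* : ∀ i t j d n .{{_ : ℕ.NonZero n}} → i ℤ.* + n ≡ t ℤ.* j ℤ.* d →
        i / n ≡ t / 1 ℚ.* (j / n) ℚ.* (d / n)
/-≡-* i t j d n@(suc n-1) p = ℚ.toℚᵘ-injective (begin
  toℚᵘ (i / n)                                             ≈⟨ toℚᵘ-/ i n-1 ⟩
  mkℚᵘ i n-1                                               ≈⟨ *≡* cross ⟩
  mkℚᵘ t 0 ℚᵘ.* mkℚᵘ j n-1 ℚᵘ.* mkℚᵘ d n-1
    ≈⟨ ℚᵘ.*-cong (ℚᵘ.*-cong (toℚᵘ-/ t 0) (toℚᵘ-/ j n-1)) (toℚᵘ-/ d n-1) ⟨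
  toℚᵘ (t / 1) ℚᵘ.* toℚᵘ (j / n) ℚᵘ.* toℚᵘ (d / n)
    ≈⟨ ℚᵘ.*-congʳ (ℚ.toℚᵘ-homo-* (t / 1) (j / n)) ⟨
  toℚᵘ (t / 1 ℚ.* (j / n)) ℚᵘ.* toℚᵘ (d / n)
    ≈⟨ ℚ.toℚᵘ-homo-* (t / 1 ℚ.* (j / n)) (d / n) ⟨
  toℚᵘ (t / 1 ℚ.* (j / n) ℚ.* (d / n))                     ∎)
  where
  open ℚᵘ.≃-Reasoning
  ring₁ : ∀ i k → i ℤ.* ((ℤ.1ℤ ℤ.* k) ℤ.* k) ≡ (i ℤ.* k) ℤ.* k
  ring₁ = ℤ-Solver.solve-∀

  cross : i ℤ.* ((ℤ.1ℤ ℤ.* + n) ℤ.* + n) ≡ (t ℤ.* j ℤ.* d) ℤ.* + n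
  cross = trans (ring₁ i (+ n)) (cong (ℤ._* + n) p)

open ≡-Reasoning

/-nonZero : ∀ i n .{{_ : ℕ.NonZero n}} → i ≢ ℤ.0ℤ → NonZero (i / n)
/-nonZero i n@(suc n-1) i≢0 = ≢-nonZero λ p →
  i≢0 (↥≡0 (ℚ./-injective-≃ (mkℚᵘ i n-1) (mkℚᵘ ℤ.0ℤ 0) p))
  where
  ↥≡0 : mkℚᵘ i n-1 ℚᵘ.≃ mkℚᵘ ℤ.0ℤ 0 → i ≡ ℤ.0ℤ
  ↥≡0 (*≡* p) = trans (sym (ℤ.*-identityʳ i)) p

-- Clears both divisions from the ratio of biases: `d` becomes the probability of the condition and
-- `x` the unconditional bias, and only a product identity remains to be checked.
÷-÷ : ∀ p q t x d .{{_ : NonZero x}} .{{_ : NonZero d}} → p ℚ.- q ≡ t ℚ.* x ℚ.* d →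
      (p ÷ d ℚ.- q ÷ d) ÷ x ≡ t
÷-÷ p q t x d eq = begin
  (p ℚ.* d⁻¹ ℚ.- q ℚ.* d⁻¹) ℚ.* x⁻¹
    ≡⟨ cong (λ z → (p ℚ.* d⁻¹ ℚ.+ z) ℚ.* x⁻¹) (ℚ.neg-distribˡ-* q d⁻¹) ⟩
  (p ℚ.* d⁻¹ ℚ.+ (ℚ.- q) ℚ.* d⁻¹) ℚ.* x⁻¹
    ≡⟨ cong (ℚ._* x⁻¹) (ℚ.*-distribʳ-+ d⁻¹ p (ℚ.- q)) ⟨
  (p ℚ.- q) ℚ.* d⁻¹ ℚ.* x⁻¹
    ≡⟨ cong (λ z → z ℚ.* d⁻¹ ℚ.* x⁻¹) eq ⟩
  t ℚ.* x ℚ.* d ℚ.* d⁻¹ ℚ.* x⁻¹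
    ≡⟨ cong (ℚ._* x⁻¹) (cancel (t ℚ.* x) d) ⟩
  t ℚ.* x ℚ.* x⁻¹
    ≡⟨ cancel t x ⟩
  t ∎
  where
  d⁻¹ = 1/ d
  x⁻¹ = 1/ x

  cancel : ∀ y z .{{_ : NonZero z}} → y ℚ.* z ℚ.* 1/ z ≡ y
  cancel y z = trans (ℚ.*-assoc y z (1/ z))
                     (trans (cong (y ℚ.*_) (ℚ.*-inverseʳ z)) (ℚ.*-identityʳ y))

-- Indicators and signs

𝟙-cong : (P → Q) → (Q → P) → (P? : Dec P) (Q? : Dec Q) → 𝟙 P? ≡ 𝟙 Q?
𝟙-cong f g P? Q? rewrite does-⇔ (mk⇔ f g) P? Q? = refl

𝟙-true : (P? : Dec P) → P → 𝟙 P? ≡ 1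
𝟙-true P? p rewrite dec-true P? p = refl

𝟙-false : (P? : Dec P) → ¬ P → 𝟙 P? ≡ 0
𝟙-false P? ¬p rewrite dec-false P? ¬p = refl

-- The mean of this sign over all samples is the bias of the event.
sgn : Dec P → ℤ
sgn P? = if does P? then ℤ.1ℤ else ℤ.-1ℤ

+-congˡ : ∀ x {y z : ℤ} → y ≡ z → x ℤ.+ y ≡ x ℤ.+ z
+-congˡ x = cong (λ y → x ℤ.+ y)

-- Sums over lists

total : List X → (X → ℤ) → ℤ
total []       f = ℤ.0ℤ
total (x ∷ xs) f = f x ℤ.+ total xs f

syntax total xs (λ x → e) = ∑[ x ∈ xs ] e

total-cong : (xs : List X) {f g : X → ℤ} → (∀ x → f x ≡ g x) → total xs f ≡ total xs g
total-cong []       f≗g = refl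
total-cong (x ∷ xs) f≗g = cong₂ ℤ._+_ (f≗g x) (total-cong xs f≗g)

total-0 : (xs : List X) {f : X → ℤ} → (∀ x → f x ≡ ℤ.0ℤ) → total xs f ≡ ℤ.0ℤ
total-0 []       f≗0 = refl
total-0 (x ∷ xs) f≗0 = cong₂ ℤ._+_ (f≗0 x) (total-0 xs f≗0)

private
  +-interchange : ∀ a b c d → a ℤ.+ b ℤ.+ (c ℤ.+ d) ≡ a ℤ.+ c ℤ.+ (b ℤ.+ d)
  +-interchange = ℤ-Solver.solve-∀

total-+ : (xs : List X) (f g : X → ℤ) →
          ∑[ x ∈ xs ] (f x ℤ.+ g x) ≡ total xs f ℤ.+ total xs g
total-+ []       f g = refl
total-+ (x ∷ xs) f g = trans (+-congˡ (f x ℤ.+ g x) (total-+ xs f g))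
                             (+-interchange (f x) (g x) (total xs f) (total xs g))

total-++ : (xs ys : List X) (f : X → ℤ) → total (xs ++ ys) f ≡ total xs f ℤ.+ total ys f
total-++ []       ys f = sym (ℤ.+-identityˡ (total ys f))
total-++ (x ∷ xs) ys f =
  trans (+-congˡ (f x) (total-++ xs ys f)) (sym (ℤ.+-assoc (f x) (total xs f) (total ys f)))

total-map : (h : X → Y) (xs : List X) (f : Y → ℤ) → total (map h xs) f ≡ total xs (f ∘ h)
total-map h []       f = refl
total-map h (x ∷ xs) f = +-congˡ (f (h x)) (total-map h xs f)

total-cartesianProductWith : (h : X → Y → Z) (xs : List X) (ys : List Y) (f : Z → ℤ) →
  total (cartesianProductWith h xs ys) f ≡ ∑[ x ∈ xs ] ∑[ y ∈ ys ] f (h x y)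
total-cartesianProductWith h []       ys f = refl
total-cartesianProductWith h (x ∷ xs) ys f =
  trans (total-++ (map (h x) ys) _ f)
        (cong₂ ℤ._+_ (total-map (h x) ys f) (total-cartesianProductWith h xs ys f))

length-filter : {P : Pred X 0ℓ} (P? : Decidable P) (xs : List X) →
                + length (filter P? xs) ≡ ∑[ x ∈ xs ] (+ 𝟙 (P? x))
length-filter P? []       = refl
length-filter P? (x ∷ xs) with does (P? x)
... | true  = cong ℤ.suc (length-filter P? xs)
... | false = trans (length-filter P? xs) (sym (ℤ.+-identityˡ _))

private
  +1-swap : ∀ x y → ℤ.1ℤ ℤ.+ x ℤ.- y ≡ ℤ.1ℤ ℤ.+ (x ℤ.- y)
  +1-swap = ℤ-Solver.solve-∀

  -1-swap : ∀ x y → x ℤ.- (ℤ.1ℤ ℤ.+ y) ≡ ℤ.-1ℤ ℤ.+ (x ℤ.- y)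
  -1-swap = ℤ-Solver.solve-∀

length-filter-∁ : {P : Pred X 0ℓ} (P? : Decidable P) (xs : List X) →
  + length (filter P? xs) ℤ.- + length (filter (∁? P?) xs) ≡ ∑[ x ∈ xs ] sgn (P? x)
length-filter-∁ P? []       = refl
length-filter-∁ P? (x ∷ xs) with does (P? x)
... | true  = trans (+1-swap (+ length (filter P? xs)) (+ length (filter (∁? P?) xs)))
                    (+-congˡ ℤ.1ℤ (length-filter-∁ P? xs))
... | false = trans (-1-swap (+ length (filter P? xs)) (+ length (filter (∁? P?) xs)))
                    (+-congˡ ℤ.-1ℤ (length-filter-∁ P? xs))

length-filter-∁-∩ : {P Q : Pred X 0ℓ} (P? : Decidable P) (Q? : Decidable Q) (xs : List X) →
  + length (filter (P? ∩? Q?) xs) ℤ.- + length (filter (∁? P? ∩? Q?) xs) ≡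
  ∑[ x ∈ xs ] (+ 𝟙 (Q? x) ℤ.* sgn (P? x))
length-filter-∁-∩ P? Q? []       = refl
length-filter-∁-∩ P? Q? (x ∷ xs) with does (P? x) | does (Q? x)
... | true  | true  = trans (+1-swap (+ length (filter (P? ∩? Q?) xs))
                                    (+ length (filter (∁? P? ∩? Q?) xs)))
                            (+-congˡ ℤ.1ℤ (length-filter-∁-∩ P? Q? xs))
... | true  | false = trans (length-filter-∁-∩ P? Q? xs) (sym (ℤ.+-identityˡ _))
... | false | true  = trans (-1-swap (+ length (filter (P? ∩? Q?) xs))
                                    (+ length (filter (∁? P? ∩? Q?) xs)))
                            (+-congˡ ℤ.-1ℤ (length-filter-∁-∩ P? Q? xs))
... | false | false = trans (length-filter-∁-∩ P? Q? xs) (sym (ℤ.+-identityˡ _))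

-- Sums over subsets and pairs of subsets

total-words₂ : (a b : X) (f : Vec X (suc m) → ℤ) →
  total (words (a ∷ b ∷ []) (suc m)) f ≡
  total (words (a ∷ b ∷ []) m) (f ∘ (a ∷_)) ℤ.+ total (words (a ∷ b ∷ []) m) (f ∘ (b ∷_))
total-words₂ {m = m} a b f =
  trans (total-cartesianProductWith _∷_ (a ∷ b ∷ []) ws f)
        (+-congˡ (total ws (f ∘ (a ∷_))) (ℤ.+-identityʳ (total ws (f ∘ (b ∷_)))))
  where ws = words (a ∷ b ∷ []) m

total-const : (xs : List X) (c : ℤ) → ∑[ _ ∈ xs ] c ≡ + length xs ℤ.* c
total-const []       c = refl
total-const (x ∷ xs) c = trans (+-congˡ c (total-const xs c)) (sym (ℤ.suc-* (+ length xs) c))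

total-1 : (xs : List X) → ∑[ _ ∈ xs ] ℤ.1ℤ ≡ + length xs
total-1 xs = trans (total-const xs ℤ.1ℤ) (ℤ.*-identityʳ (+ length xs))

length-words₂ : (a b : X) (m : ℕ) → length (words (a ∷ b ∷ []) m) ≡ 2 ^ m
length-words₂ a b zero    = refl
length-words₂ a b (suc m) = ℤ.+-injective (begin
  + length ws′                     ≡⟨ total-1 ws′ ⟨
  ∑[ _ ∈ ws′ ] ℤ.1ℤ                ≡⟨ total-words₂ {m = m} a b (λ _ → ℤ.1ℤ) ⟩
  _                                ≡⟨ cong₂ ℤ._+_ (total-1 ws) (total-1 ws) ⟩
  + (length ws ℕ.+ length ws)      ≡⟨ cong (λ l → + (l ℕ.+ l)) (length-words₂ a b m) ⟩
  + (2 ^ m ℕ.+ 2 ^ m)              ≡⟨ cong (λ l → + (2 ^ m ℕ.+ l)) (ℕ.+-identityʳ (2 ^ m)) ⟨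
  + (2 ^ suc m)                    ∎)
  where
  ws  = words (a ∷ b ∷ []) m
  ws′ = words (a ∷ b ∷ []) (suc m)

-- Translation by `P` permutes the subsets: at each element of `P` it swaps the half of the sum with
-- that element and the half without it.
total-subsets-△ : (P : Subset m) (f : Subset m → ℤ) →
                  ∑[ A ∈ subsets m ] f (P △ A) ≡ total (subsets m) f
total-subsets-△ []            f = refl
total-subsets-△ {suc m} (outside ∷ P) f = begin
  total (subsets (suc m)) (f ∘ ((outside ∷ P) △_))
    ≡⟨ total-words₂ outside inside (f ∘ ((outside ∷ P) △_)) ⟩
  _ ≡⟨ cong₂ ℤ._+_ (total-subsets-△ P (f ∘ (outside ∷_))) (total-subsets-△ P (f ∘ (inside ∷_))) ⟩
  _ ≡⟨ total-words₂ outside inside f ⟨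
  total (subsets (suc m)) f ∎
total-subsets-△ {suc m} (inside ∷ P) f = begin
  total (subsets (suc m)) (f ∘ ((inside ∷ P) △_))
    ≡⟨ total-words₂ outside inside (f ∘ ((inside ∷ P) △_)) ⟩
  _ ≡⟨ cong₂ ℤ._+_ (total-subsets-△ P (f ∘ (inside ∷_))) (total-subsets-△ P (f ∘ (outside ∷_))) ⟩
  _ ≡⟨ ℤ.+-comm (total (subsets m) (f ∘ (inside ∷_))) _ ⟩
  _ ≡⟨ total-words₂ outside inside f ⟨
  total (subsets (suc m)) f ∎

total-samples : (f : Subset m × Subset m → ℤ) →
  total samples f ≡ ∑[ A ∈ subsets m ] ∑[ B ∈ subsets m ] f (A , B)
total-samples {m} f = total-cartesianProductWith _,_ (subsets m) (subsets m) f

total-samples-suc : (f : Subset (suc m) × Subset (suc m) → ℤ) →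
  total samples f ≡
  (total samples (λ (A , B) → f (outside ∷ A , outside ∷ B)) ℤ.+
   total samples (λ (A , B) → f (outside ∷ A , inside  ∷ B))) ℤ.+
  (total samples (λ (A , B) → f (inside  ∷ A , outside ∷ B)) ℤ.+
   total samples (λ (A , B) → f (inside  ∷ A , inside  ∷ B)))
total-samples-suc {m} f = begin
  total samples f
    ≡⟨ total-samples f ⟩
  ∑[ A ∈ subsets (suc m) ] ∑[ B ∈ subsets (suc m) ] f (A , B)
    ≡⟨ total-words₂ {m = m} outside inside (λ A → ∑[ B ∈ subsets (suc m) ] f (A , B)) ⟩
  _ ≡⟨ cong₂ ℤ._+_ (row outside) (row inside) ⟩
  _ ∎
  where
  row : ∀ x → ∑[ A ∈ subsets m ] ∑[ B ∈ subsets (suc m) ] f (x ∷ A , B) ≡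
              total samples (λ (A , B) → f (x ∷ A , outside ∷ B)) ℤ.+
              total samples (λ (A , B) → f (x ∷ A , inside  ∷ B))
  row x = begin
    _ ≡⟨ total-cong (subsets m) (λ A → total-words₂ outside inside (λ B → f (x ∷ A , B))) ⟩
    _ ≡⟨ total-+ (subsets m) (λ A → ∑[ B ∈ subsets m ] f (x ∷ A , outside ∷ B))
                             (λ A → ∑[ B ∈ subsets m ] f (x ∷ A , inside ∷ B)) ⟩
    _ ≡⟨ cong₂ ℤ._+_ (total-samples {m} (λ (A , B) → f (x ∷ A , outside ∷ B)))
                     (total-samples {m} (λ (A , B) → f (x ∷ A , inside ∷ B))) ⟨
    _ ∎

length-samples : + length (samples {m}) ≡ + (2 ^ m) ℤ.* + (2 ^ m)
length-samples {m} = begin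
  + length (samples {m})                                 ≡⟨ total-1 (samples {m}) ⟨
  ∑[ _ ∈ samples {m} ] ℤ.1ℤ                              ≡⟨ total-samples {m} (λ _ → ℤ.1ℤ) ⟩
  ∑[ _ ∈ subsets m ] ∑[ _ ∈ subsets m ] ℤ.1ℤ             ≡⟨ total-const (subsets m) _ ⟩
  + length (subsets m) ℤ.* ∑[ _ ∈ subsets m ] ℤ.1ℤ
    ≡⟨ cong (λ l → + length (subsets m) ℤ.* l) (total-1 (subsets m)) ⟩
  + length (subsets m) ℤ.* + length (subsets m)
    ≡⟨ cong (λ l → + l ℤ.* + l) (length-words₂ outside inside m) ⟩
  + (2 ^ m) ℤ.* + (2 ^ m)                                ∎

-- For each fixed `A`, the set `A △ B` runs through every subset exactly once as `B` does.
total-samples-△ : (h : Subset m → ℤ) →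
  total samples (λ (A , B) → h (A △ B)) ≡ + (2 ^ m) ℤ.* total (subsets m) h
total-samples-△ {m} h = begin
  total samples (λ (A , B) → h (A △ B))
    ≡⟨ total-samples (λ (A , B) → h (A △ B)) ⟩
  ∑[ A ∈ subsets m ] ∑[ B ∈ subsets m ] h (A △ B)
    ≡⟨ total-cong (subsets m) (λ A → total-subsets-△ A h) ⟩
  ∑[ A ∈ subsets m ] total (subsets m) h
    ≡⟨ total-const (subsets m) _ ⟩
  + length (subsets m) ℤ.* total (subsets m) h
    ≡⟨ cong (λ l → + l ℤ.* total (subsets m) h) (length-words₂ outside inside m) ⟩
  + (2 ^ m) ℤ.* total (subsets m) h ∎

-- Induction on the edges, splitting by whether the first edge lies in `A` and in `B`. Both `h` and
-- `f` have to vary: fixing the first edge restricts `h` to sets with or without it and shifts the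
-- argument of `f` by 0, 1 or 2, and every shift of `f` is again antiperiodic.
total-samples-antiperiodic : (h : Subset m → ℤ) (f : ℕ → ℤ) → (∀ j → f (2 ℕ.+ j) ≡ ℤ.- f j) →
  total samples (λ (A , B) → h (A △ B) ℤ.* f (∣ A ∣ ℕ.+ ∣ B ∣)) ≡ + (2 ^ m) ℤ.* (h ⊤ ℤ.* f m)
total-samples-antiperiodic {zero}  h f anti = ring (h []) (f 0)
  where
  ring : ∀ x y → x ℤ.* y ℤ.+ ℤ.0ℤ ≡ ℤ.1ℤ ℤ.* (x ℤ.* y)
  ring = ℤ-Solver.solve-∀
total-samples-antiperiodic {suc m} h f anti = begin
  _ ≡⟨ total-samples-suc {m} _ ⟩
  _ ≡⟨ cong₂ ℤ._+_
         (cong₂ ℤ._+_ (total-samples-antiperiodic (h ∘ (outside ∷_)) f anti) mixed)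
         (cong₂ ℤ._+_ (total-samples-antiperiodic (h ∘ (inside ∷_)) (λ j → f (1 ℕ.+ j)) (λ j → anti (1 ℕ.+ j)))
                      (trans (shift (λ A B → outside ∷ (A △ B)) 1) (total-samples-antiperiodic
                        (h ∘ (outside ∷_)) (λ j → f (2 ℕ.+ j)) (λ j → anti (2 ℕ.+ j))))) ⟩
  p ℤ.* (x ℤ.* f m) ℤ.+ p ℤ.* (y ℤ.* f (suc m)) ℤ.+
  (p ℤ.* (y ℤ.* f (suc m)) ℤ.+ p ℤ.* (x ℤ.* f (suc (suc m))))
    -- With the first edge in both sets, `f` is shifted by 2, so this term is the negative of the
    -- one with the edge in neither. The two mixed terms are equal and supply the factor 2 in
    -- `2 ^ suc m`.
    ≡⟨ cong (λ z → p ℤ.* (x ℤ.* f m) ℤ.+ p ℤ.* (y ℤ.* f (suc m)) ℤ.+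
                   (p ℤ.* (y ℤ.* f (suc m)) ℤ.+ p ℤ.* (x ℤ.* z))) (anti m) ⟩
  _ ≡⟨ ring p x y (f m) (f (suc m)) ⟩
  (p ℤ.+ (p ℤ.+ ℤ.0ℤ)) ℤ.* (y ℤ.* f (suc m)) ∎
  where
  p x y : ℤ
  p = + (2 ^ m)
  x = h (outside ∷ ⊤)
  y = h (inside ∷ ⊤)

  shift : (k : Subset m → Subset m → Subset (suc m)) (i : ℕ) →
    total samples (λ (A , B) → h (k A B) ℤ.* f (i ℕ.+ (∣ A ∣ ℕ.+ suc ∣ B ∣))) ≡
    total samples (λ (A , B) → h (k A B) ℤ.* f (i ℕ.+ suc (∣ A ∣ ℕ.+ ∣ B ∣)))
  shift k i = total-cong samples λ (A , B) →
    cong (λ j → h (k A B) ℤ.* f (i ℕ.+ j)) (ℕ.+-suc ∣ A ∣ ∣ B ∣)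

  mixed : total samples (λ (A , B) → h (inside ∷ (A △ B)) ℤ.* f (∣ A ∣ ℕ.+ suc ∣ B ∣)) ≡
          p ℤ.* (y ℤ.* f (suc m))
  mixed = trans (shift (λ A B → inside ∷ (A △ B)) 0)
                (total-samples-antiperiodic (h ∘ (inside ∷_)) (λ j → f (1 ℕ.+ j)) (λ j → anti (1 ℕ.+ j)))

  ring : ∀ p x y u v →
    p ℤ.* (x ℤ.* u) ℤ.+ p ℤ.* (y ℤ.* v) ℤ.+ (p ℤ.* (y ℤ.* v) ℤ.+ p ℤ.* (x ℤ.* (ℤ.- u))) ≡
    (p ℤ.+ (p ℤ.+ ℤ.0ℤ)) ℤ.* (y ℤ.* v)
  ring = ℤ-Solver.solve-∀

-- Recursion in steps of two, so that the antiperiodicity required above holds by computation.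
sizeSign : ℕ → ℤ
sizeSign 0             = ℤ.1ℤ
sizeSign 1             = ℤ.1ℤ
sizeSign (suc (suc n)) = ℤ.- sizeSign n

sgn-size : (AB : Subset m × Subset m) →
           sgn (size≡0,1[mod4]? AB) ≡ sizeSign (∣ proj₁ AB ∣ ℕ.+ ∣ proj₂ AB ∣)
sgn-size (A , B) = sgn-mod4 (∣ A ∣ ℕ.+ ∣ B ∣)
  where
  sgn-mod4 : ∀ j → sgn ((j % 4 ℕ.≟ 0) ⊎-dec (j % 4 ℕ.≟ 1)) ≡ sizeSign j
  sgn-mod4 0 = refl
  sgn-mod4 1 = refl
  sgn-mod4 2 = refl
  sgn-mod4 3 = refl
  sgn-mod4 (suc (suc (suc (suc j)))) =
    trans (sgn-mod4 j) (sym (ℤ.neg-involutive (sizeSign j)))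

sizeSign≢0 : ∀ j → sizeSign j ≢ ℤ.0ℤ
sizeSign≢0 0             ()
sizeSign≢0 1             ()
sizeSign≢0 (suc (suc j)) p = sizeSign≢0 j (ℤ.neg-injective p)

-- Eulerian subsets

Ends : ℕ → ℕ → Set
Ends n m = Fin m → Fin n × Fin n

graph : Ends n m → Graph
graph ends = record { ends = ends }

-- Used in two ways: as the contribution of an edge to the degrees, and as the boundary of a path
-- from `u` to `v`. For `u = v` it is twice an indicator, hence even everywhere.
incidence : Fin n × Fin n → Fin n → ℕ
incidence (u , v) w = 𝟙 (u ≟ w) ℕ.+ 𝟙 (v ≟ w)

even-double : ∀ j → 2 ∣ j ℕ.+ j
even-double j = divides j (ring j)
  where
  ring : ∀ j → j ℕ.+ j ≡ j * 2
  ring = ℕ-Solver.solve-∀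

-- The common last step of the parity arguments below: a sum of even numbers is rearranged into the
-- wanted number plus a doubled remainder.
even-cancel : ∀ {i} j k → 2 ∣ i → i ≡ k ℕ.+ (j ℕ.+ j) → 2 ∣ k
even-cancel j k 2∣i refl =
  ∣m+n∣m⇒∣n (subst (2 ∣_) (ℕ.+-comm k (j ℕ.+ j)) 2∣i) (even-double j)

degree-⊥ : (ends : Ends n m) (v : Fin n) → degree (graph ends) ⊥ v ≡ 0
degree-⊥ {m = zero}  ends v = refl
degree-⊥ {m = suc m} ends v = degree-⊥ (ends ∘ suc) v

degree-⁅⁆ : (ends : Ends n m) (e : Fin m) (v : Fin n) →
            degree (graph ends) ⁅ e ⁆ v ≡ incidence (ends e) v
degree-⁅⁆ ends zero    v =
  trans (cong (incidence (ends zero) v ℕ.+_) (degree-⊥ (ends ∘ suc) v)) (ℕ.+-identityʳ _)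
degree-⁅⁆ ends (suc e) v = degree-⁅⁆ (ends ∘ suc) e v

-- Every edge lies in none or in exactly two of `A`, `B` and `A △ B`, so its incidence is counted
-- zero times or twice. Stating this as evenness of a sum avoids subtraction.
degree-△ : (ends : Ends n m) (A B : Subset m) (v : Fin n) →
  2 ∣ degree (graph ends) A v ℕ.+ degree (graph ends) B v ℕ.+ degree (graph ends) (A △ B) v
degree-△ ends []       []       v = 2 ∣0
degree-△ ends (x ∷ A) (y ∷ B) v = extend x y
  where
  d = incidence (ends zero) v
  a = degree (graph (ends ∘ suc)) A v
  b = degree (graph (ends ∘ suc)) B v
  c = degree (graph (ends ∘ suc)) (A △ B) v

  rest : 2 ∣ a ℕ.+ b ℕ.+ c
  rest = degree-△ (ends ∘ suc) A B v

  with-double : ∀ {i} → (d ℕ.+ d) ℕ.+ (a ℕ.+ b ℕ.+ c) ≡ i → 2 ∣ i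
  with-double p = subst (2 ∣_) p (∣m∣n⇒∣m+n (even-double d) rest)

  ring₁₁ : ∀ d a b c → (d ℕ.+ d) ℕ.+ (a ℕ.+ b ℕ.+ c) ≡ (d ℕ.+ a) ℕ.+ (d ℕ.+ b) ℕ.+ c
  ring₁₁ = ℕ-Solver.solve-∀

  ring₁₀ : ∀ d a b c → (d ℕ.+ d) ℕ.+ (a ℕ.+ b ℕ.+ c) ≡ (d ℕ.+ a) ℕ.+ b ℕ.+ (d ℕ.+ c)
  ring₁₀ = ℕ-Solver.solve-∀

  ring₀₁ : ∀ d a b c → (d ℕ.+ d) ℕ.+ (a ℕ.+ b ℕ.+ c) ≡ a ℕ.+ (d ℕ.+ b) ℕ.+ (d ℕ.+ c)
  ring₀₁ = ℕ-Solver.solve-∀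

  extend : ∀ x y → 2 ∣ degree (graph ends) (x ∷ A) v ℕ.+ degree (graph ends) (y ∷ B) v ℕ.+
                       degree (graph ends) ((x xor y) ∷ (A △ B)) v
  extend false false = rest
  extend false true  = with-double (ring₀₁ d a b c)
  extend true  false = with-double (ring₁₀ d a b c)
  extend true  true  = with-double (ring₁₁ d a b c)

-- The sets P with odd degrees exactly at T (mod 2).
HasBoundary : Ends n m → (Fin n → ℕ) → Pred (Subset m) 0ℓ
HasBoundary ends T P = ∀ v → 2 ∣ T v ℕ.+ degree (graph ends) P v

hasBoundary? : (ends : Ends n m) (T : Fin n → ℕ) → Decidable (HasBoundary ends T)
hasBoundary? ends T P = all? λ v → 2 ∣? (T v ℕ.+ degree (graph ends) P v)

-- Being the boundary of some edge set is an equivalence relation on pairs of vertices: the empty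
-- set gives reflexivity, the same set symmetry, and symmetric difference transitivity. A single
-- edge relates its own ends, so the relation contains connectedness.
connected⇒boundary : (ends : Ends n m) {u v : Fin n} → EqClosure (Joined ends) u v →
                     ∃ (HasBoundary ends (incidence (u , v)))
connected⇒boundary {n} {m} ends = Eq.fold isEquiv λ { {u} {v} (e , p) → ⁅ e ⁆ , λ w →
    subst (2 ∣_) (cong (incidence (u , v) w ℕ.+_)
      (sym (trans (degree-⁅⁆ ends e w) (cong (λ uv → incidence uv w) p))))
      (even-double (incidence (u , v) w)) }
  where
  deg = degree (graph ends)

  isEquiv : IsEquivalence (λ u v → ∃ (HasBoundary ends (incidence (u , v))))
  isEquiv = record
    { refl  = λ {u} → ⊥ , λ w → subst (2 ∣_) (sym (trans
                (cong (incidence (u , u) w ℕ.+_) (degree-⊥ ends w)) (ℕ.+-identityʳ _)))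
                (even-double (𝟙 (u ≟ w)))
    ; sym   = λ { {u} {v} (A , ∂A) → A , λ w →
                subst (λ i → 2 ∣ i ℕ.+ deg A w) (ℕ.+-comm (𝟙 (u ≟ w)) (𝟙 (v ≟ w))) (∂A w) }
    ; trans = λ { {t} {u} {v} (A , ∂A) (B , ∂B) → A △ B , λ w →
                even-cancel (𝟙 (u ≟ w) ℕ.+ (deg A w ℕ.+ deg B w))
                  (𝟙 (t ≟ w) ℕ.+ 𝟙 (v ≟ w) ℕ.+ deg (A △ B) w)
                  (∣m∣n⇒∣m+n (∣m∣n⇒∣m+n (∂A w) (∂B w)) (degree-△ ends A B w))
                  (ring (𝟙 (t ≟ w)) (𝟙 (u ≟ w)) (𝟙 (v ≟ w)) (deg A w) (deg B w) (deg (A △ B) w)) }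
    }
    where
    ring : ∀ t u v a b c →
      (t ℕ.+ u ℕ.+ a) ℕ.+ (u ℕ.+ v ℕ.+ b) ℕ.+ (a ℕ.+ b ℕ.+ c) ≡
      (t ℕ.+ v ℕ.+ c) ℕ.+ ((u ℕ.+ (a ℕ.+ b)) ℕ.+ (u ℕ.+ (a ℕ.+ b)))
    ring = ℕ-Solver.solve-∀

∑-even : (f : Fin n → ℕ) → (∀ v → 2 ∣ f v) → 2 ∣ ∑ f
∑-even {zero}  f even = 2 ∣0
∑-even {suc n} f even = ∣m∣n⇒∣m+n (even zero) (∑-even (f ∘ suc) (even ∘ suc))

∑-zero : (f : Fin n → ℕ) → (∀ v → f v ≡ 0) → ∑ f ≡ 0
∑-zero {zero}  f f≗0 = refl
∑-zero {suc n} f f≗0 = cong₂ ℕ._+_ (f≗0 zero) (∑-zero (f ∘ suc) (f≗0 ∘ suc))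

∑-𝟙 : (f : Fin n → ℕ) (u : Fin n) → ∑ (λ v → f v * 𝟙 (u ≟ v)) ≡ f u
∑-𝟙 {suc n} f zero    = begin
  f zero * 1 ℕ.+ ∑ (λ v → f (suc v) * 0)
    ≡⟨ cong₂ ℕ._+_ (ℕ.*-identityʳ (f zero)) (∑-zero _ (λ v → ℕ.*-zeroʳ (f (suc v)))) ⟩
  f zero ℕ.+ 0
    ≡⟨ ℕ.+-identityʳ (f zero) ⟩
  f zero ∎
∑-𝟙 {suc n} f (suc u) = begin
  f zero * 0 ℕ.+ ∑ (λ v → f (suc v) * 𝟙 (u ≟ v))
    ≡⟨ cong₂ ℕ._+_ (ℕ.*-zeroʳ (f zero)) (∑-𝟙 (f ∘ suc) u) ⟩
  f (suc u) ∎

∑-*-+ : (χ f g : Fin n → ℕ) →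
        ∑ (λ v → χ v * (f v ℕ.+ g v)) ≡ ∑ (λ v → χ v * f v) ℕ.+ ∑ (λ v → χ v * g v)
∑-*-+ χ f g = trans (sum-cong-≗ ℕ.+-0-monoid (λ v → ℕ.*-distribˡ-+ (χ v) (f v) (g v)))
                    (∑-distrib-+ ℕ.+-0-commutativeMonoid (λ v → χ v * f v) (λ v → χ v * g v))

∑-incidence : (χ : Fin n → ℕ) (uv : Fin n × Fin n) →
              ∑ (λ w → χ w * incidence uv w) ≡ χ (proj₁ uv) ℕ.+ χ (proj₂ uv)
∑-incidence χ (u , v) = trans (∑-*-+ χ (λ w → 𝟙 (u ≟ w)) (λ w → 𝟙 (v ≟ w)))
                              (cong₂ ℕ._+_ (∑-𝟙 χ u) (∑-𝟙 χ v))

-- The handshake lemma inside a union of components with characteristic function χ.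
handshake : (ends : Ends n m) (χ : Fin n → ℕ) → (∀ e → χ (proj₁ (ends e)) ≡ χ (proj₂ (ends e))) →
            (A : Subset m) → 2 ∣ ∑ (λ v → χ v * degree (graph ends) A v)
handshake ends χ χ-cong []            = ∑-even _ (λ v → ∣n⇒∣m*n (χ v) (2 ∣0))
handshake ends χ χ-cong (outside ∷ A) = handshake (ends ∘ suc) χ (χ-cong ∘ suc) A
handshake ends χ χ-cong (inside ∷ A)  = subst (2 ∣_)
  (sym (∑-*-+ χ (incidence (ends zero)) (degree (graph (ends ∘ suc)) A)))
  (∣m∣n⇒∣m+n (subst (2 ∣_) (sym one-edge) (even-double (χ (proj₁ (ends zero)))))
             (handshake (ends ∘ suc) χ (χ-cong ∘ suc) A))
  where
  one-edge : ∑ (λ v → χ v * incidence (ends zero) v) ≡ χ (proj₁ (ends zero)) ℕ.+ χ (proj₁ (ends zero))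
  one-edge = trans (∑-incidence χ (ends zero)) (cong (χ (proj₁ (ends zero)) ℕ.+_) (sym (χ-cong zero)))

-- Sum the boundary condition over the component of `u`. The total would be even, but the degrees in
-- a component already sum to an even number, and of `u` and `v` only `u` lies there, adding 1.
disconnected⇒¬boundary : ∀ {k} (ends : Ends n m) (c : Classes ends k) {u v : Fin n} →
  Bijection.to c u ≢ Bijection.to c v → (A : Subset m) → ¬ HasBoundary ends (incidence (u , v)) A
disconnected⇒¬boundary ends c {u} {v} u≁v A ∂A = case ∣1⇒≡1 2∣1 of λ ()
  where
  open Bijection c using (to) renaming (cong to to-cong)

  χ : Fin _ → ℕ
  χ w = 𝟙 (to u ≟ to w)

  χ-cong : ∀ e → χ (proj₁ (ends e)) ≡ χ (proj₂ (ends e))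
  χ-cong e = cong (λ y → 𝟙 (to u ≟ y)) (to-cong (Eq.return (e , refl)))

  sums : ∑ (λ w → χ w * (incidence (u , v) w ℕ.+ degree (graph ends) A w)) ≡
         ∑ (λ w → χ w * degree (graph ends) A w) ℕ.+ 1
  sums = begin
    _ ≡⟨ ∑-*-+ χ (incidence (u , v)) (degree (graph ends) A) ⟩
    _ ≡⟨ cong (ℕ._+ D) (∑-incidence χ (u , v)) ⟩
    χ u ℕ.+ χ v ℕ.+ D
      ≡⟨ cong (ℕ._+ D) (cong₂ ℕ._+_ (𝟙-true (to u ≟ to u) refl) (𝟙-false (to u ≟ to v) u≁v)) ⟩
    1 ℕ.+ D ≡⟨ ℕ.+-comm 1 D ⟩
    D ℕ.+ 1 ∎
    where D = ∑ (λ w → χ w * degree (graph ends) A w)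

  2∣1 : 2 ∣ 1
  2∣1 = ∣m+n∣m⇒∣n (subst (2 ∣_) sums (∑-even _ (λ w → ∣n⇒∣m*n (χ w) (∂A w))))
                  (handshake ends χ χ-cong A)

-- Counting eulerian subsets through the rank

#boundary : Ends n m → (Fin n → ℕ) → ℤ
#boundary {m = m} ends T = ∑[ A ∈ subsets m ] (+ 𝟙 (hasBoundary? ends T A))

#eulerian : Ends n m → ℤ
#eulerian {m = m} ends = ∑[ A ∈ subsets m ] (+ 𝟙 (eulerian? (graph ends) A))

-- Split by whether the first edge is used. If it is, the remaining edges must balance its
-- incidence, and the two conditions agree by computation.
#eulerian-suc : (ends : Ends n (suc m)) →
  #eulerian ends ≡ #eulerian (ends ∘ suc) ℤ.+ #boundary (ends ∘ suc) (incidence (ends zero))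
#eulerian-suc ends = total-words₂ outside inside (λ A → + 𝟙 (eulerian? (graph ends) A))

-- The sets with boundary `T` form a coset of the eulerian sets: translation by one solution `P`
-- carries the former to the latter.
#boundary-attained : (ends : Ends n m) (T : Fin n → ℕ) → ∃ (HasBoundary ends T) →
                     #boundary ends T ≡ #eulerian ends
#boundary-attained {m = m} ends T (P , ∂P) = begin
  #boundary ends T
    ≡⟨ total-cong (subsets m) (λ A → cong +_
         (𝟙-cong (to A) (from A) (hasBoundary? ends T A) (eulerian? (graph ends) (P △ A)))) ⟩
  ∑[ A ∈ subsets m ] (+ 𝟙 (eulerian? (graph ends) (P △ A)))
    ≡⟨ total-subsets-△ P _ ⟩
  #eulerian ends ∎
  where
  deg = degree (graph ends)

  to : ∀ A → HasBoundary ends T A → Eulerian (graph ends) (P △ A)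
  to A ∂A v = even-cancel (T v ℕ.+ (deg P v ℕ.+ deg A v)) (deg (P △ A) v)
    (∣m∣n⇒∣m+n (∣m∣n⇒∣m+n (∂P v) (∂A v)) (degree-△ ends P A v))
    (ring (T v) (deg P v) (deg A v) (deg (P △ A) v))
    where
    ring : ∀ t p a c → (t ℕ.+ p) ℕ.+ (t ℕ.+ a) ℕ.+ (p ℕ.+ a ℕ.+ c) ≡
                       c ℕ.+ ((t ℕ.+ (p ℕ.+ a)) ℕ.+ (t ℕ.+ (p ℕ.+ a)))
    ring = ℕ-Solver.solve-∀

  from : ∀ A → Eulerian (graph ends) (P △ A) → HasBoundary ends T A
  from A eul v = even-cancel (deg P v ℕ.+ deg (P △ A) v) (T v ℕ.+ deg A v)
    (∣m∣n⇒∣m+n (∣m∣n⇒∣m+n (∂P v) (eul v)) (degree-△ ends P A v))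
    (ring (T v) (deg P v) (deg A v) (deg (P △ A) v))
    where
    ring : ∀ t p a c → (t ℕ.+ p) ℕ.+ c ℕ.+ (p ℕ.+ a ℕ.+ c) ≡
                       (t ℕ.+ a) ℕ.+ ((p ℕ.+ c) ℕ.+ (p ℕ.+ c))
    ring = ℕ-Solver.solve-∀

#classes : Ends n m → ℕ
#classes ends = proj₁ (classes ends)

-- Exposes the case split by which `classes` is computed. The first case yields the connection from
-- which a boundary is built, the second the distinct classes that obstruct one.
edgeStep : (ends : Ends n (suc m)) (let to = Bijection.to (proj₂ (classes (ends ∘ suc)))) →
  EqClosure (Joined (ends ∘ suc)) (proj₁ (ends zero)) (proj₂ (ends zero)) ×
    #classes ends ≡ #classes (ends ∘ suc) ⊎
  to (proj₁ (ends zero)) ≢ to (proj₂ (ends zero)) ×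
    suc (#classes ends) ≡ #classes (ends ∘ suc)
edgeStep ends with classes (ends ∘ suc)
... | k , c with Bijection.to c (proj₁ (ends zero)) ≟ Bijection.to c (proj₂ (ends zero))
edgeStep ends | k , c     | yes p = inj₁ (Bijection.injective c p , refl)
edgeStep ends | suc k , c | no p  = inj₂ (p , refl)
edgeStep ends | zero , c  | no p  = case Bijection.to c (proj₁ (ends zero)) of λ ()

-- Makes the truncated subtraction in `r` exact, so that losing one component raises the rank by
-- one.
#classes≤ : (ends : Ends n m) → #classes ends ≤ n
#classes≤ {m = zero}  ends = ℕ.≤-refl
#classes≤ {m = suc m} ends with edgeStep ends
... | inj₁ (_ , p) = ℕ.≤-trans (ℕ.≤-reflexive p) (#classes≤ (ends ∘ suc))
... | inj₂ (_ , p) = ℕ.≤-trans (ℕ.n≤1+n _) (ℕ.≤-trans (ℕ.≤-reflexive p) (#classes≤ (ends ∘ suc)))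

-- The eulerian sets are the cycle space over the field of two elements, of dimension `m` minus the
-- rank. The product form keeps subtraction out of the exponent on the right.
rank-nullity : (ends : Ends n m) → + (2 ^ r (graph ends)) ℤ.* #eulerian ends ≡ + (2 ^ m)
rank-nullity {n} {zero}  ends = begin
  + (2 ^ (n ∸ n)) ℤ.* #eulerian ends
    ≡⟨ cong₂ (λ i j → + (2 ^ i) ℤ.* (+ j ℤ.+ ℤ.0ℤ)) (ℕ.n∸n≡0 n)
         (𝟙-true (eulerian? (graph ends) []) (λ v → 2 ∣0)) ⟩
  + 1 ∎
rank-nullity {n} {suc m} ends with edgeStep ends
-- The new edge closes a cycle: the rank stays, and as many eulerian sets use the edge as avoid it.
... | inj₁ (a~b , p) = begin
  + (2 ^ (n ∸ #classes ends)) ℤ.* #eulerian ends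
    ≡⟨ cong₂ (λ i N → + (2 ^ (n ∸ i)) ℤ.* N) p (trans (#eulerian-suc ends)
         (cong (λ N → #eulerian (ends ∘ suc) ℤ.+ N) (#boundary-attained (ends ∘ suc) _
           (connected⇒boundary (ends ∘ suc) a~b)))) ⟩
  R ℤ.* (N ℤ.+ N)             ≡⟨ ℤ.*-distribˡ-+ R N N ⟩
  R ℤ.* N ℤ.+ R ℤ.* N         ≡⟨ cong₂ ℤ._+_ (rank-nullity (ends ∘ suc)) (rank-nullity (ends ∘ suc)) ⟩
  + (2 ^ m ℕ.+ 2 ^ m)         ≡⟨ cong (λ l → + (2 ^ m ℕ.+ l)) (ℕ.+-identityʳ (2 ^ m)) ⟨
  + (2 ^ suc m)               ∎
  where
  R = + (2 ^ (n ∸ #classes (ends ∘ suc)))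
  N = #eulerian (ends ∘ suc)
-- The new edge is a bridge: the rank grows by one, and no eulerian set uses the edge.
... | inj₂ (a≁b , p) = begin
  + (2 ^ (n ∸ #classes ends)) ℤ.* #eulerian ends
    ≡⟨ cong₂ (λ i N → + (2 ^ i) ℤ.* N) rank-suc
         (trans (#eulerian-suc ends) (trans (+-congˡ N unattained) (ℤ.+-identityʳ N))) ⟩
  + (2 * 2 ^ r′) ℤ.* N          ≡⟨ cong (ℤ._* N) (ℤ.pos-* 2 (2 ^ r′)) ⟩
  + 2 ℤ.* + (2 ^ r′) ℤ.* N      ≡⟨ ℤ.*-assoc (+ 2) (+ (2 ^ r′)) N ⟩
  + 2 ℤ.* (+ (2 ^ r′) ℤ.* N)    ≡⟨ cong (λ l → + 2 ℤ.* l) (rank-nullity (ends ∘ suc)) ⟩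
  + 2 ℤ.* + (2 ^ m)             ≡⟨ ℤ.pos-* 2 (2 ^ m) ⟨
  + (2 ^ suc m)                 ∎
  where
  N  = #eulerian (ends ∘ suc)
  r′ = n ∸ #classes (ends ∘ suc)

  rank-suc : n ∸ #classes ends ≡ suc r′
  rank-suc = begin
    suc n ∸ suc (#classes ends)         ≡⟨ cong (suc n ∸_) p ⟩
    suc n ∸ #classes (ends ∘ suc)       ≡⟨ ℕ.+-∸-assoc 1 (#classes≤ (ends ∘ suc)) ⟩
    suc r′                              ∎

  unattained : #boundary (ends ∘ suc) (incidence (ends zero)) ≡ ℤ.0ℤ
  unattained = total-0 (subsets m) λ A → cong +_
    (𝟙-false (hasBoundary? (ends ∘ suc) _ A)
      (disconnected⇒¬boundary (ends ∘ suc) (proj₂ (classes (ends ∘ suc))) a≁b A))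

-- Nowhere-zero ℤ/2-flows

-- A nowhere-zero word over two residues is 1 everywhere, so a sum supported on nowhere-zero words
-- has a single term.
total-words-ones : (h : Vec (Fin 2) m → ℤ) → (∀ w e → lookup w e ≡ zero → h w ≡ ℤ.0ℤ) →
                   total (words (allFin 2) m) h ≡ h (replicate m (suc zero))
total-words-ones {zero}  h h≗0 = ℤ.+-identityʳ (h [])
total-words-ones {suc m} h h≗0 = begin
  total (words (allFin 2) (suc m)) h
    ≡⟨ total-words₂ zero (suc zero) h ⟩
  total ws (h ∘ (zero ∷_)) ℤ.+ total ws (h ∘ (suc zero ∷_))
    ≡⟨ cong₂ ℤ._+_ (total-0 ws (λ w → h≗0 (zero ∷ w) zero refl))
         (total-words-ones (h ∘ (suc zero ∷_)) (λ w e → h≗0 (suc zero ∷ w) (suc e))) ⟩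
  ℤ.0ℤ ℤ.+ h (replicate (suc m) (suc zero))
    ≡⟨ ℤ.+-identityˡ _ ⟩
  h (replicate (suc m) (suc zero)) ∎
  where ws = words (allFin 2) m

%2-≡⇒2∣+ : ∀ x y → x % 2 ≡ y % 2 → 2 ∣ x ℕ.+ y
%2-≡⇒2∣+ x y p = subst (2 ∣_) (sym eq)
  (∣m∣n⇒∣m+n (even-double (y % 2)) (n∣m*n (x ℕ./ 2 ℕ.+ y ℕ./ 2)))
  where
  ring : ∀ a b c → (a ℕ.+ b * 2) ℕ.+ (a ℕ.+ c * 2) ≡ (a ℕ.+ a) ℕ.+ (b ℕ.+ c) * 2
  ring = ℕ-Solver.solve-∀

  eq : x ℕ.+ y ≡ (y % 2 ℕ.+ y % 2) ℕ.+ (x ℕ./ 2 ℕ.+ y ℕ./ 2) * 2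
  eq = begin
    x ℕ.+ y
      ≡⟨ cong₂ ℕ._+_ (m≡m%n+[m/n]*n x 2) (m≡m%n+[m/n]*n y 2) ⟩
    (x % 2 ℕ.+ x ℕ./ 2 * 2) ℕ.+ (y % 2 ℕ.+ y ℕ./ 2 * 2)
      ≡⟨ cong (λ z → (z ℕ.+ x ℕ./ 2 * 2) ℕ.+ (y % 2 ℕ.+ y ℕ./ 2 * 2)) p ⟩
    (y % 2 ℕ.+ x ℕ./ 2 * 2) ℕ.+ (y % 2 ℕ.+ y ℕ./ 2 * 2)
      ≡⟨ ring (y % 2) (x ℕ./ 2) (y ℕ./ 2) ⟩
    _ ∎

2∣+⇒%2-≡ : ∀ x y → 2 ∣ x ℕ.+ y → x % 2 ≡ y % 2
2∣+⇒%2-≡ x y (divides q p) = begin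
  x % 2                   ≡⟨ [m+kn]%n≡m%n x y 2 ⟨
  -- Adding `y` twice keeps the residue of `x` and exposes the even number `x + y`.
  (x ℕ.+ y * 2) % 2       ≡⟨ cong (_% 2) (ring x y) ⟩
  (y ℕ.+ (x ℕ.+ y)) % 2   ≡⟨ cong (λ z → (y ℕ.+ z) % 2) p ⟩
  (y ℕ.+ q * 2) % 2       ≡⟨ [m+kn]%n≡m%n y q 2 ⟩
  y % 2                   ∎
  where
  ring : ∀ x y → x ℕ.+ y * 2 ≡ y ℕ.+ (x ℕ.+ y)
  ring = ℕ-Solver.solve-∀

-- The only candidate is the all-ones word. Modulo 2 its outflow and inflow agree at a vertex
-- exactly when their sum is even, and that sum is the degree in the whole edge set.
F₂≡𝟙-eulerian : (G : Graph) (o : Orientation G) → + F G o 2 ≡ + 𝟙 (eulerian? G ⊤)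
F₂≡𝟙-eulerian G o = begin
  + F G o 2
    ≡⟨ length-filter flow? (words (allFin 2) #E) ⟩
  ∑[ w ∈ words (allFin 2) #E ] (+ 𝟙 (flow? w))
    ≡⟨ total-words-ones _ (λ w e p → cong +_ (𝟙-false (flow? w) (λ (_ , nz) → nz e (cong toℕ p)))) ⟩
  + 𝟙 (flow? ones)
    ≡⟨ cong +_ (𝟙-cong flow⇒eulerian eulerian⇒flow (flow? ones) (eulerian? G ⊤)) ⟩
  + 𝟙 (eulerian? G ⊤) ∎
  where
  open Graph G
  open Orientation o

  flow? = isFlow? G o 2 ∩? nowhereZero? G o 2

  one : Fin 2
  one = suc zero

  ones : Vec (Fin 2) #E
  ones = replicate #E one

  ones-1 : ∀ e → toℕ (lookup ones e) ≡ 1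
  ones-1 e = cong toℕ (lookup-replicate e one)

  out in′ : Fin #V → ℕ
  out = outflow G o 2 ones
  in′ = inflow G o 2 ones

  incidence-oriented : ∀ e v → incidence (ends e) v ≡ 𝟙 (tail e ≟ v) ℕ.+ 𝟙 (head e ≟ v)
  incidence-oriented e v with orients e
  ... | inj₁ p = cong (λ uw → incidence uw v) (sym p)
  ... | inj₂ p = trans (ℕ.+-comm (𝟙 (proj₁ (ends e) ≟ v)) _) (cong (λ uw → incidence uw v) (sym p))

  degree-⊤ : ∀ v → degree G ⊤ v ≡ out v ℕ.+ in′ v
  degree-⊤ v = trans (sum-cong-≗ ℕ.+-0-monoid per-edge) (∑-distrib-+ ℕ.+-0-commutativeMonoid
    (λ e → 𝟙 (tail e ≟ v) * toℕ (lookup ones e)) (λ e → 𝟙 (head e ≟ v) * toℕ (lookup ones e)))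
    where
    per-edge : ∀ e → (if lookup ⊤ e then incidence (ends e) v else 0) ≡
      𝟙 (tail e ≟ v) * toℕ (lookup ones e) ℕ.+ 𝟙 (head e ≟ v) * toℕ (lookup ones e)
    per-edge e rewrite lookup-replicate e inside | ones-1 e
                     | ℕ.*-identityʳ (𝟙 (tail e ≟ v)) | ℕ.*-identityʳ (𝟙 (head e ≟ v)) =
      incidence-oriented e v

  flow⇒eulerian : IsFlow G o 2 ones × NowhereZero G o 2 ones → Eulerian G ⊤
  flow⇒eulerian (flow , _) v =
    subst (2 ∣_) (sym (degree-⊤ v)) (%2-≡⇒2∣+ (out v) (in′ v) (flow v))

  eulerian⇒flow : Eulerian G ⊤ → IsFlow G o 2 ones × NowhereZero G o 2 ones
  eulerian⇒flow eul =
    (λ v → 2∣+⇒%2-≡ (out v) (in′ v) (subst (2 ∣_) (degree-⊤ v) (eul v))) ,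
    (λ e p → case trans (sym (ones-1 e)) p of λ ())

-- The ratio of the two biases

theorem2p18 : (G : Graph) (o : Orientation G) →
    let S? = size≡0,1[mod4]? {Graph.#E G}
        Δ? = △-eulerian? G
    in Σ[ ℙΔ≢0 ∈ NonZero (ℙ Δ?) ] Σ[ BiasS≢0 ∈ NonZero (Bias S?) ]
       (_÷_ (Bias[_∣_] S? Δ? {{ℙΔ≢0}}) (Bias S?) {{BiasS≢0}} ≡ + (2 ^ r G * F G o 2) / 1)
theorem2p18 G o = ℙΔ≢0 , BiasS≢0 ,
  ÷-÷ (ℙ (S? ∩? Δ?)) (ℙ (∁? S? ∩? Δ?)) (+ (2 ^ r G * F G o 2) / 1) (Bias S?) (ℙ Δ?)
      {{BiasS≢0}} {{ℙΔ≢0}} (begin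
    ℙ (S? ∩? Δ?) ℚ.- ℙ (∁? S? ∩? Δ?)
      ≡⟨ minus (S? ∩? Δ?) (∁? S? ∩? Δ?) ⟩
    _/_ (# (S? ∩? Δ?) ℤ.- # (∁? S? ∩? Δ?)) N {{N≢0}}
      ≡⟨ /-≡-* (# (S? ∩? Δ?) ℤ.- # (∁? S? ∩? Δ?)) (+ (2 ^ r G * F G o 2))
              (# S? ℤ.- # (∁? S?)) (# Δ?) N {{N≢0}} counts ⟩
    + (2 ^ r G * F G o 2) / 1 ℚ.* (_/_ (# S? ℤ.- # (∁? S?)) N {{N≢0}}) ℚ.* ℙ Δ?
      ≡⟨ cong (λ b → + (2 ^ r G * F G o 2) / 1 ℚ.* b ℚ.* ℙ Δ?) (minus S? (∁? S?)) ⟨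
    + (2 ^ r G * F G o 2) / 1 ℚ.* Bias S? ℚ.* ℙ Δ? ∎)
  where
  open Graph G

  S? = size≡0,1[mod4]? {#E}
  Δ? = △-eulerian? G

  N : ℕ
  N = length (samples {#E})

  # : {P : Pred (Subset #E × Subset #E) 0ℓ} → Decidable P → ℤ
  # P? = + length (filter P? samples)

  N≢0 : ℕ.NonZero N
  N≢0 = samples≢0 {#E}

  minus : {P Q : Pred (Subset #E × Subset #E) 0ℓ} (P? : Decidable P) (Q? : Decidable Q) →
          ℙ P? ℚ.- ℙ Q? ≡ _/_ (# P? ℤ.- # Q?) N {{N≢0}}
  minus P? Q? = /-distrib-minus (# P?) (# Q?) N {{N≢0}}

  p s eul : ℤ
  p   = + (2 ^ #E)
  s   = sizeSign #E
  eul = + 𝟙 (eulerian? G ⊤)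

  p≢0 : p ≢ ℤ.0ℤ
  p≢0 eq = ℕ.<⇒≢ (ℕ.m^n>0 2 #E) (sym (ℤ.+-injective eq))

  #S : # S? ℤ.- # (∁? S?) ≡ p ℤ.* s
  #S = begin
    # S? ℤ.- # (∁? S?)
      ≡⟨ length-filter-∁ S? samples ⟩
    total samples (λ AB → sgn (S? AB))
      ≡⟨ total-cong (samples {#E}) (λ AB → trans (sgn-size AB) (sym (ℤ.*-identityˡ _))) ⟩
    total (samples {#E}) (λ (A , B) → ℤ.1ℤ ℤ.* sizeSign (∣ A ∣ ℕ.+ ∣ B ∣))
      ≡⟨ total-samples-antiperiodic {#E} (λ _ → ℤ.1ℤ) sizeSign (λ _ → refl) ⟩
    p ℤ.* (ℤ.1ℤ ℤ.* s)
      ≡⟨ cong (λ z → p ℤ.* z) (ℤ.*-identityˡ s) ⟩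
    p ℤ.* s ∎

  #SΔ : # (S? ∩? Δ?) ℤ.- # (∁? S? ∩? Δ?) ≡ p ℤ.* (eul ℤ.* s)
  #SΔ = begin
    # (S? ∩? Δ?) ℤ.- # (∁? S? ∩? Δ?)
      ≡⟨ length-filter-∁-∩ S? Δ? samples ⟩
    total samples (λ AB → + 𝟙 (Δ? AB) ℤ.* sgn (S? AB))
      ≡⟨ total-cong samples (λ AB → cong (λ z → + 𝟙 (Δ? AB) ℤ.* z) (sgn-size AB)) ⟩
    total samples (λ (A , B) → + 𝟙 (eulerian? G (A △ B)) ℤ.* sizeSign (∣ A ∣ ℕ.+ ∣ B ∣))
      ≡⟨ total-samples-antiperiodic (λ C → + 𝟙 (eulerian? G C)) sizeSign (λ _ → refl) ⟩
    p ℤ.* (eul ℤ.* s) ∎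

  #Δ : # Δ? ≡ p ℤ.* #eulerian ends
  #Δ = trans (length-filter Δ? samples) (total-samples-△ (λ C → + 𝟙 (eulerian? G C)))

  counts : (# (S? ∩? Δ?) ℤ.- # (∁? S? ∩? Δ?)) ℤ.* + N ≡
           + (2 ^ r G * F G o 2) ℤ.* (# S? ℤ.- # (∁? S?)) ℤ.* # Δ?
  counts = begin
    (# (S? ∩? Δ?) ℤ.- # (∁? S? ∩? Δ?)) ℤ.* + N
      ≡⟨ cong₂ ℤ._*_ #SΔ (length-samples {#E}) ⟩
    p ℤ.* (eul ℤ.* s) ℤ.* (p ℤ.* p)
      -- Of the two factors `2 ^ #E` in the number of samples, one is split into the power of the
      -- rank and the number of eulerian sets; the other joins that number to give the count of
      -- `Δ?`.
      ≡⟨ cong (λ z → p ℤ.* (eul ℤ.* s) ℤ.* (p ℤ.* z)) (rank-nullity ends) ⟨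
    p ℤ.* (eul ℤ.* s) ℤ.* (p ℤ.* (+ (2 ^ r G) ℤ.* #eulerian ends))
      ≡⟨ ring p eul s (+ (2 ^ r G)) (#eulerian ends) ⟩
    + (2 ^ r G) ℤ.* eul ℤ.* (p ℤ.* s) ℤ.* (p ℤ.* #eulerian ends)
      ≡⟨ cong (λ z → + (2 ^ r G) ℤ.* z ℤ.* (p ℤ.* s) ℤ.* (p ℤ.* #eulerian ends)) (F₂≡𝟙-eulerian G o) ⟨
    + (2 ^ r G) ℤ.* + F G o 2 ℤ.* (p ℤ.* s) ℤ.* (p ℤ.* #eulerian ends)
      ≡⟨ cong (λ z → z ℤ.* (p ℤ.* s) ℤ.* (p ℤ.* #eulerian ends)) (ℤ.pos-* (2 ^ r G) (F G o 2)) ⟨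
    + (2 ^ r G * F G o 2) ℤ.* (p ℤ.* s) ℤ.* (p ℤ.* #eulerian ends)
      ≡⟨ cong₂ (λ y z → + (2 ^ r G * F G o 2) ℤ.* y ℤ.* z) #S #Δ ⟨
    + (2 ^ r G * F G o 2) ℤ.* (# S? ℤ.- # (∁? S?)) ℤ.* # Δ? ∎
    where
    ring : ∀ p e s R N → p ℤ.* (e ℤ.* s) ℤ.* (p ℤ.* (R ℤ.* N)) ≡ R ℤ.* e ℤ.* (p ℤ.* s) ℤ.* (p ℤ.* N)
    ring = ℤ-Solver.solve-∀

  ℙΔ≢0 : NonZero (ℙ Δ?)
  ℙΔ≢0 = /-nonZero (# Δ?) N {{N≢0}} λ eq → case ℤ.i*j≡0⇒i≡0∨j≡0 p (trans (sym #Δ) eq) of λ where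
    (inj₁ p≡0) → p≢0 p≡0
    -- Without eulerian sets, `rank-nullity` would make `2 ^ #E` vanish.
    (inj₂ N≡0) → p≢0 (trans (sym (rank-nullity ends))
                            (trans (cong (λ z → + (2 ^ r G) ℤ.* z) N≡0) (ℤ.*-zeroʳ (+ (2 ^ r G)))))

  BiasS≢0 : NonZero (Bias S?)
  BiasS≢0 = subst NonZero (sym (minus S? (∁? S?)))
    -- The numerator is a power of two times a sign, and neither factor is zero.
    (/-nonZero (# S? ℤ.- # (∁? S?)) N {{N≢0}} λ eq →
      case ℤ.i*j≡0⇒i≡0∨j≡0 p (trans (sym #S) eq) of λ where
        (inj₁ p≡0) → p≢0 p≡0
        (inj₂ s≡0) → sizeSign≢0 #E s≡0)
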